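{- Let $\lambda$ be a partition of $n$ and $\lambda'$ its conjugate partition. Then for every integer $m$, $$|\mathrm{QYT}_{=m}(\lambda)|=|\mathrm{QYT}_{=(n+1)-m}(\lambda')|.$$
   Context: A partition $\lambda=(\lambda_1\ge\cdots\ge\lambda_k>0)$ of $n$ has (French) Young diagram with $\lambda_j$ left-justified boxes in row $j$, rows numbered from bottom to top; the conjugate partition $\lambda'$ is the partition whose diagram is obtained by reflecting that of $\lambda$ across the main diagonal (so $\lambda'_i$ is the number of boxes in column $i$ of $\lambda$). A semistandard Young tableau (SSYT) of shape $\lambda$ is a filling of the boxes with positive integers weakly increasing left to right along rows and strictly increasing bottom to top along columns. An SSYT $T$ is quasi-Yamanouchi if for every integer $i>1$ appearing in $T$, the leftmost occurrence of $i$ lies in a column weakly left of (column index $\le$) some occurrence of $i-1$. $\mathrm{QYT}_{=m}(\lambda)$ is the set of quasi-Yamanouchi tableaux of shape $\lambda$ whose largest entry is exactly $m$. -}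

module Defs where

open import Data.Bool using (if_then_else_; true; false)
open import Data.Fin using (Fin; toℕ)
open import Data.Integer as ℤ using (ℤ; +_)
open import Data.List using (List; []; _∷_; length; lookup; filter; applyUpTo)
open import Data.List.Relation.Unary.All as All using (All; []; _∷_)
import Data.List.Relation.Unary.All.Properties as AllP
open import Data.List.Relation.Unary.Linked using (Linked; []; [-]; _∷_)
import Data.List.Relation.Unary.Linked.Properties as LinkedP
open import Data.Nat using (ℕ; zero; suc; _+_; _∸_; _≤_; _<_; _≥_; _<ᵇ_; _<?_; z≤n; s≤s; z<s)
open import Data.Nat.ListAction using (sum)
open import Data.Nat.Properties using (≤-refl; ≤-trans; <-≤-trans; m≤m+n; +-mono-≤; +-commutativeSemigroup)
open import Data.Product using (∃; _×_)
open import Level using (0ℓ)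
open import Relation.Binary.Bundles using (Setoid)
open import Relation.Binary.PropositionalEquality using (_≡_; refl; sym; trans; cong; cong₂; subst; subst₂)
open import Algebra.Properties.CommutativeSemigroup +-commutativeSemigroup using (interchange)

record Partition (n : ℕ) : Set where
  field
    parts      : List ℕ
    decreasing : Linked _≥_ parts
    positive   : All (0 <_) parts
    sum-parts  : sum parts ≡ n

open Partition public

-- Rows and columns are indexed from 0, so column i meets exactly the rows of
-- length > i.
columnHeight : List ℕ → ℕ → ℕ
columnHeight ps i = length (filter (i <?_) ps)

width : List ℕ → ℕ
width []      = 0
width (p ∷ _) = p

conjugateParts : List ℕ → List ℕ
conjugateParts ps = applyUpTo (columnHeight ps) (width ps)

indicator : ℕ → ℕ → ℕ
indicator p i = if i <ᵇ p then 1 else 0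

columnHeight-∷ : ∀ p ps i → columnHeight (p ∷ ps) i ≡ indicator p i + columnHeight ps i
columnHeight-∷ p ps i with i <ᵇ p
... | true  = refl
... | false = refl

indicator-antitone : ∀ p i → indicator p (suc i) ≤ indicator p i
indicator-antitone zero          i       = z≤n
indicator-antitone (suc zero)    zero    = z≤n
indicator-antitone (suc (suc p)) zero    = ≤-refl
indicator-antitone (suc p)       (suc i) = indicator-antitone p i

indicator-positive : ∀ {p i} → i < p → 0 < indicator p i
indicator-positive {suc p} {zero}  _         = z<s
indicator-positive {suc p} {suc i} (s≤s i<p) = indicator-positive i<p

columnHeight-antitone : ∀ ps i → columnHeight ps i ≥ columnHeight ps (suc i)
columnHeight-antitone []       i = z≤n
columnHeight-antitone (p ∷ ps) i =
  subst₂ _≤_ (sym (columnHeight-∷ p ps (suc i))) (sym (columnHeight-∷ p ps i))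
    (+-mono-≤ (indicator-antitone p i) (columnHeight-antitone ps i))

columnHeight-positive : ∀ ps {i} → i < width ps → 0 < columnHeight ps i
columnHeight-positive (p ∷ ps) {i} i<p =
  subst (0 <_) (sym (columnHeight-∷ p ps i)) (<-≤-trans (indicator-positive i<p) (m≤m+n _ _))

sum-+ : ∀ (f g h : ℕ → ℕ) w → (∀ i → f i ≡ g i + h i) →
        sum (applyUpTo f w) ≡ sum (applyUpTo g w) + sum (applyUpTo h w)
sum-+ f g h zero    eq = refl
sum-+ f g h (suc w) eq = trans
  (cong₂ _+_ (eq 0) (sum-+ _ (λ i → g (suc i)) (λ i → h (suc i)) w (λ i → eq (suc i))))
  (interchange (g 0) (h 0) _ _)

sum-zero : ∀ w → sum (applyUpTo (λ _ → 0) w) ≡ 0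
sum-zero zero    = refl
sum-zero (suc w) = sum-zero w

sum-indicator : ∀ {p w} → p ≤ w → sum (applyUpTo (indicator p) w) ≡ p
sum-indicator {w = w} z≤n = sum-zero w
sum-indicator (s≤s p≤w)   = cong suc (sum-indicator p≤w)

sum-columnHeight : ∀ {w} ps → All (_≤ w) ps → sum (applyUpTo (columnHeight ps) w) ≡ sum ps
sum-columnHeight {w} []       []          = sum-zero w
sum-columnHeight {w} (p ∷ ps) (p≤w ∷ ps≤w) = trans
  (sum-+ _ (indicator p) (columnHeight ps) w (columnHeight-∷ p ps))
  (cong₂ _+_ (sum-indicator p≤w) (sum-columnHeight ps ps≤w))

parts≤width : ∀ {ps} → Linked _≥_ ps → All (_≤ width ps) ps
parts≤width []            = []
parts≤width [-]           = ≤-refl ∷ []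
parts≤width (p≥q ∷ q∷ps↓) =
  ≤-refl ∷ All.map (λ r≤q → ≤-trans r≤q p≥q) (parts≤width q∷ps↓)

conjugate : ∀ {n} → Partition n → Partition n
conjugate μ = record
  { parts      = conjugateParts (parts μ)
  ; decreasing = LinkedP.applyUpTo⁺₂ _ (width (parts μ)) (columnHeight-antitone (parts μ))
  ; positive   = AllP.applyUpTo⁺₁ _ (width (parts μ)) (columnHeight-positive (parts μ))
  ; sum-parts  = trans (sum-columnHeight (parts μ) (parts≤width (decreasing μ))) (sum-parts μ)
  }

-- Row 0 is the bottom row.
record Box {n : ℕ} (μ : Partition n) : Set where
  constructor box
  field
    rowIndex : Fin (length (parts μ))
    colIndex : Fin (lookup (parts μ) rowIndex)

  row : ℕ
  row = toℕ rowIndex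

  col : ℕ
  col = toℕ colIndex

open Box public

Filling : ∀ {n} → Partition n → Set
Filling μ = Box μ → ℕ

module _ {n : ℕ} {μ : Partition n} where

  record IsSSYT (T : Filling μ) : Set where
    field
      entries-positive   : ∀ b → 0 < T b
      rows-weakly-incr   : ∀ b c → row b ≡ row c → col b < col c → T b ≤ T c
      cols-strictly-incr : ∀ b c → col b ≡ col c → row b < row c → T b < T c

  IsLeftmostOccurrence : Filling μ → ℕ → Box μ → Set
  IsLeftmostOccurrence T i b = T b ≡ i × (∀ c → T c ≡ i → col b ≤ col c)

  IsQuasiYamanouchi : Filling μ → Set
  IsQuasiYamanouchi T =
    ∀ i → 1 < i → (∃ λ b → T b ≡ i) →
    ∃ λ b → IsLeftmostOccurrence T i b ×
    ∃ λ c → T c ≡ i ∸ 1 × col b ≤ col c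

  -- The empty filling has no largest entry.
  IsLargestEntry : Filling μ → ℤ → Set
  IsLargestEntry T m = (∃ λ b → + T b ≡ m) × (∀ b → + T b ℤ.≤ m)

record QYT (m : ℤ) {n : ℕ} (μ : Partition n) : Set where
  field
    filling         : Filling μ
    isSSYT          : IsSSYT filling
    quasiYamanouchi : IsQuasiYamanouchi filling
    largestEntry    : IsLargestEntry filling m

open QYT public

-- Tableaux are equal when their entries agree; the proof components of QYT
-- play no role, so this setoid is the set of tableaux.
QYT₌ : ℤ → ∀ {n} → Partition n → Setoid 0ℓ 0ℓ
QYT₌ m μ = record
  { Carrier       = QYT m μ
  ; _≈_           = λ S T → ∀ b → filling S b ≡ filling T b
  ; isEquivalence = record
    { refl  = λ _ → refl
    ; sym   = λ p b → sym (p b)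
    ; trans = λ p q b → trans (p b) (q b)
    }
  }

{-# OPTIONS --safe #-}
-- Order the boxes of a quasi-Yamanouchi tableau T by (entry, column)
-- lexicographically and let rank b be the number of boxes before b.  Along
-- this order the entry either stays the same or increases by one at each step,
-- and quasi-Yamanouchi says that it increases exactly at the steps that move
-- weakly left.  Hence b ↦ 2 + rank b − T b increases by one exactly at the
-- other steps.  It is a quasi-Yamanouchi filling of the conjugate shape that
-- induces the same order, so the construction is an involution; on the last
-- box it takes the value n + 1 − m.
module Submission where

open import Defs
open import Data.Nat using (ℕ; zero; suc; _+_; _∸_; _≤_; _<_; _≥_; _<?_; z≤n; s≤s; s≤s⁻¹; z<s)
open import Data.Nat.Properties
open import Data.Fin as Fin using (Fin; zero; suc; toℕ; fromℕ<; splitAt; _↑ˡ_; _↑ʳ_; punchOut)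
open import Data.Fin.Properties as Fin using (toℕ-injective; toℕ-fromℕ<; toℕ<n; any?; punchOut-injective; injective⇒≤; splitAt-↑ˡ; splitAt-↑ʳ; splitAt⁻¹-↑ˡ; splitAt⁻¹-↑ʳ)
open import Data.Integer as ℤ using (ℤ; +_; _-_)
import Data.Integer.Properties as ℤ
open import Data.List using (List; []; _∷_; length; lookup; applyUpTo)
open import Data.List.Properties using (filter-accept; filter-none; length-applyUpTo)
open import Data.List.Relation.Unary.All as All using (All; []; _∷_)
open import Data.List.Relation.Unary.Linked as Linked using (Linked)
open import Data.Nat.ListAction using (sum)
open import Data.Product using (Σ; ∃; _×_; _,_; proj₁; proj₂)
open import Data.Sum using (_⊎_; inj₁; inj₂)
open import Data.Unit using (tt)
open import Function.Base using (_∘_)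
open import Function.Bundles using (Inverse)
open import Function.Definitions using (Injective)
open import Level using (0ℓ)
open import Relation.Binary.Definitions using (tri<; tri≈; tri>)
open import Relation.Binary.PropositionalEquality
open import Relation.Nullary using (¬_; Dec; yes; no; contradiction)
open import Relation.Nullary.Decidable using (_×-dec_; _⊎-dec_)
open import Relation.Unary using (Pred; Decidable)

-- Finite counting

-- Pigeonhole: if `y` were missed, punching it out of the codomain would inject `Fin (suc n)` into
-- `Fin n`.
injective⇒surjective : ∀ {n} {f : Fin n → Fin n} → Injective _≡_ _≡_ f → ∀ y → ∃ λ x → f x ≡ y
injective⇒surjective {suc n} {f} inj y with any? (λ x → f x Fin.≟ y)
... | yes found = found
... | no  ¬hit  = contradiction
  (injective⇒≤ {f = λ x → punchOut (miss x)} (λ {i} {j} eq → inj (punchOut-injective (miss i) (miss j) eq)))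
  1+n≰n
  where
  miss : ∀ x → ¬ y ≡ f x
  miss x eq = ¬hit (x , sym eq)

count : ∀ {n} {P : Pred (Fin n) 0ℓ} → Decidable P → ℕ
count {zero}  P? = 0
count {suc n} P? with P? zero
... | yes _ = suc (count (P? ∘ suc))
... | no  _ = count (P? ∘ suc)

count-mono : ∀ {n} {P Q : Pred (Fin n) 0ℓ} (P? : Decidable P) (Q? : Decidable Q) →
             (∀ i → P i → Q i) → count P? ≤ count Q?
count-mono {zero}  P? Q? P⊆Q = z≤n
count-mono {suc n} P? Q? P⊆Q with P? zero | Q? zero | count-mono (P? ∘ suc) (Q? ∘ suc) (P⊆Q ∘ suc)
... | yes _ | yes _ | ih = s≤s ih
... | yes p | no ¬q | ih = contradiction (P⊆Q zero p) ¬q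
... | no _  | yes _ | ih = m≤n⇒m≤1+n ih
... | no _  | no _  | ih = ih

count-strict : ∀ {n} {P Q : Pred (Fin n) 0ℓ} (P? : Decidable P) (Q? : Decidable Q) →
               (∀ i → P i → Q i) → ∀ i → Q i → ¬ P i → count P? < count Q?
count-strict {suc n} P? Q? P⊆Q zero q ¬p with P? zero | Q? zero | count-mono (P? ∘ suc) (Q? ∘ suc) (P⊆Q ∘ suc)
... | yes p | _     | le = contradiction p ¬p
... | no _  | yes _ | le = s≤s le
... | no _  | no ¬q | le = contradiction q ¬q
count-strict {suc n} P? Q? P⊆Q (suc i) q ¬p with P? zero | Q? zero | count-strict (P? ∘ suc) (Q? ∘ suc) (P⊆Q ∘ suc) i q ¬p
... | yes _ | yes _ | ih = s≤s ih
... | yes p | no ¬q | ih = contradiction (P⊆Q zero p) ¬q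
... | no _  | yes _ | ih = m≤n⇒m≤1+n ih
... | no _  | no _  | ih = ih

count≤n : ∀ {n} {P : Pred (Fin n) 0ℓ} (P? : Decidable P) → count P? ≤ n
count≤n {zero}  P? = z≤n
count≤n {suc n} P? with P? zero
... | yes _ = s≤s (count≤n (P? ∘ suc))
... | no  _ = m≤n⇒m≤1+n (count≤n (P? ∘ suc))

count<n : ∀ {n} {P : Pred (Fin n) 0ℓ} (P? : Decidable P) → ∀ i → ¬ P i → count P? < n
count<n P? i ¬p =
  <-≤-trans (count-strict P? (λ _ → yes tt) (λ _ _ → tt) i tt ¬p) (count≤n (λ _ → yes tt))

-- Fillings of n numbered boxes

record Shape (n : ℕ) : Set where
  field
    rowOf colOf : Fin n → ℕ
    injective   : ∀ {x y} → rowOf x ≡ rowOf y → colOf x ≡ colOf y → x ≡ y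

open Shape

-- `flip (flip S)` is definitionally `S`, so dualizing twice returns to the original shape without
-- transport.
flip : ∀ {n} → Shape n → Shape n
flip S = record { rowOf = colOf S ; colOf = rowOf S ; injective = λ p q → injective S q p }

-- The quasi-Yamanouchi condition at the value `i`: `l` is a leftmost occurrence of `i` and `d` an
-- occurrence of `i - 1` weakly to its right.
Supported : ∀ {n} → (col T : Fin n → ℕ) → ℕ → Set
Supported col T i =
  ∃ λ l → T l ≡ i × (∀ y → T y ≡ i → col l ≤ col y) ×
  ∃ λ d → suc (T d) ≡ i × col l ≤ col d

-- Monotonicity is stated for boxes comparable in both coordinates, not only within one row or
-- column. On a Young diagram this is equivalent, and it lets the duality argument run without
-- constructing intermediate boxes.
record IsQYT {n} (S : Shape n) (T : Fin n → ℕ) : Set where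
  field
    entry>0 : ∀ x → 0 < T x
    weak    : ∀ {x y} → rowOf S x ≤ rowOf S y → colOf S x ≤ colOf S y → T x ≤ T y
    strict  : ∀ {x y} → rowOf S x < rowOf S y → colOf S x ≤ colOf S y → T x < T y
    quasi   : ∀ x → 1 < T x → Supported (colOf S) T (T x)

Largest : ∀ {n} → (Fin n → ℕ) → ℤ → Set
Largest T m = (∃ λ x → + T x ≡ m) × (∀ x → + T x ℤ.≤ m)

-- The reading order, ranks and the dual filling

module ReadingOrder {n} (S : Shape n) (T : Fin n → ℕ) where

  infix 4 _≺_ _≺?_

  _≺_ : Fin n → Fin n → Set
  x ≺ y = T x < T y ⊎ T x ≡ T y × colOf S x < colOf S y

  _≺?_ : ∀ x y → Dec (x ≺ y)
  x ≺? y = T x <? T y ⊎-dec T x ≟ T y ×-dec colOf S x <? colOf S y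

  ≺-irrefl : ∀ {x} → ¬ x ≺ x
  ≺-irrefl (inj₁ p)       = <-irrefl refl p
  ≺-irrefl (inj₂ (_ , p)) = <-irrefl refl p

  ≺-trans : ∀ {x y z} → x ≺ y → y ≺ z → x ≺ z
  ≺-trans (inj₁ p)       (inj₁ q)       = inj₁ (<-trans p q)
  ≺-trans (inj₁ p)       (inj₂ (e , _)) = inj₁ (<-≤-trans p (≤-reflexive e))
  ≺-trans (inj₂ (e , _)) (inj₁ q)       = inj₁ (≤-<-trans (≤-reflexive e) q)
  ≺-trans (inj₂ (e , p)) (inj₂ (f , q)) = inj₂ (trans e f , <-trans p q)

  ≺⇒≤ : ∀ {x y} → x ≺ y → T x ≤ T y
  ≺⇒≤ (inj₁ p)       = <⇒≤ p
  ≺⇒≤ (inj₂ (e , _)) = ≤-reflexive e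

  rank : Fin n → ℕ
  rank y = count (_≺? y)

  rank-strict : ∀ {x y} → x ≺ y → rank x < rank y
  rank-strict {x} {y} x≺y = count-strict (_≺? x) (_≺? y) (λ _ z≺x → ≺-trans z≺x x≺y) x x≺y ≺-irrefl

  rank<n : ∀ x → rank x < n
  rank<n x = count<n (_≺? x) x ≺-irrefl

  -- The constant 2 makes the first box, of rank 0 and entry 1, receive the value 1.
  dual : Fin n → ℕ
  dual x = 2 + rank x ∸ T x

module _ {n} (S : Shape n) where
  open ReadingOrder S

  rank-cong : ∀ {S′ : Shape n} {T U} → let module R = ReadingOrder S′ in
              (∀ {x y} → _≺_ T x y → R._≺_ U x y) → (∀ {x y} → R._≺_ U x y → _≺_ T x y) →
              ∀ x → rank T x ≡ R.rank U x
  rank-cong {S′} {T} {U} f g x = ≤-antisym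
    (count-mono (λ z → _≺?_ T z x) (λ z → R._≺?_ U z x) (λ _ → f))
    (count-mono (λ z → R._≺?_ U z x) (λ z → _≺?_ T z x) (λ _ → g))
    where module R = ReadingOrder S′

  ≺-cong : ∀ {T U} → (∀ x → T x ≡ U x) → ∀ {x y} → _≺_ T x y → _≺_ U x y
  ≺-cong eq {x} {y} (inj₁ p)       = inj₁ (subst₂ _<_ (eq x) (eq y) p)
  ≺-cong eq {x} {y} (inj₂ (e , p)) = inj₂ (trans (sym (eq x)) (trans e (eq y)) , p)

  dual-cong : ∀ {T U} → (∀ x → T x ≡ U x) → ∀ x → dual T x ≡ dual U x
  dual-cong {T} {U} eq x = cong₂ (λ r t → 2 + r ∸ t)
    (rank-cong {S} {T} {U} (≺-cong eq) (≺-cong (sym ∘ eq)) x) (eq x)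

-- The dual of a quasi-Yamanouchi filling

module Duality {n} {S : Shape n} {T : Fin n → ℕ} (isQYT : IsQYT S T) where
  open IsQYT isQYT
  open ReadingOrder S T
  private
    row′ = rowOf S
    col′ = colOf S

  -- Totality rests on column strictness: boxes with equal entries in the same column must coincide.
  ≺-cmp : ∀ x y → x ≺ y ⊎ x ≡ y ⊎ y ≺ x
  ≺-cmp x y with <-cmp (T x) (T y) | <-cmp (col′ x) (col′ y) | <-cmp (row′ x) (row′ y)
  ... | tri< p _ _ | _          | _          = inj₁ (inj₁ p)
  ... | tri> _ _ p | _          | _          = inj₂ (inj₂ (inj₁ p))
  ... | tri≈ _ e _ | tri< q _ _ | _          = inj₁ (inj₂ (e , q))
  ... | tri≈ _ e _ | tri> _ _ q | _          = inj₂ (inj₂ (inj₂ (sym e , q)))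
  ... | tri≈ _ e _ | tri≈ _ f _ | tri≈ _ g _ = inj₂ (inj₁ (injective S g f))
  ... | tri≈ _ e _ | tri≈ _ f _ | tri< r _ _ = contradiction (strict r (≤-reflexive f)) (<-irrefl e)
  ... | tri≈ _ e _ | tri≈ _ f _ | tri> _ _ r = contradiction (strict r (≤-reflexive (sym f))) (<-irrefl (sym e))

  rank-reflects : ∀ {x y} → rank x < rank y → x ≺ y
  rank-reflects {x} {y} p with ≺-cmp x y
  ... | inj₁ x≺y         = x≺y
  ... | inj₂ (inj₁ refl) = contradiction p (<-irrefl refl)
  ... | inj₂ (inj₂ y≺x)  = contradiction (rank-strict y≺x) (<-asym p)

  rank-injective : ∀ {x y} → rank x ≡ rank y → x ≡ y
  rank-injective {x} {y} e with ≺-cmp x y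
  ... | inj₁ x≺y        = contradiction (rank-strict x≺y) (<-irrefl e)
  ... | inj₂ (inj₁ x≡y) = x≡y
  ... | inj₂ (inj₂ y≺x) = contradiction (rank-strict y≺x) (<-irrefl (sym e))

  -- Ranks are distinct and below `n`, so by the pigeonhole principle every number below `n` is
  -- attained.
  atRank : ∀ {k} → k < n → ∃ λ x → rank x ≡ k
  atRank {k} k<n with injective⇒surjective {f = λ x → fromℕ< (rank<n x)} inj (fromℕ< k<n)
    where
    inj : Injective _≡_ _≡_ (λ x → fromℕ< (rank<n x))
    inj {x} {y} e = rank-injective
      (trans (sym (toℕ-fromℕ< (rank<n x))) (trans (cong toℕ e) (toℕ-fromℕ< (rank<n y))))
  ... | x , e = x , trans (sym (toℕ-fromℕ< (rank<n x))) (trans (cong toℕ e) (toℕ-fromℕ< k<n))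

  rank-induction : (P : Fin n → Set) → (∀ {y} → rank y ≡ 0 → P y) →
                   (∀ {x y} → rank y ≡ suc (rank x) → P x → P y) → ∀ y → P y
  rank-induction P base next y = go _ y refl
    where
    go : ∀ k y → rank y ≡ k → P y
    go zero    y e = base e
    go (suc k) y e with atRank (<-trans (n<1+n k) (subst (_< n) e (rank<n y)))
    ... | x , f = next (trans e (cong suc (sym f))) (go k x f)

  -- A box strictly between `x` and `y` would have a rank strictly between consecutive numbers.
  before : ∀ {x y z} → rank y ≡ suc (rank x) → z ≺ y → z ≡ x ⊎ z ≺ x
  before {x} {y} {z} e z≺y with ≺-cmp z x
  ... | inj₁ z≺x        = inj₂ z≺x
  ... | inj₂ (inj₁ z≡x) = inj₁ z≡x
  ... | inj₂ (inj₂ x≺z) =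
    contradiction (≤-<-trans (rank-strict x≺z) (<-≤-trans (rank-strict z≺y) (≤-reflexive e))) (<-irrefl refl)

  before-≤ : ∀ {x y z} → rank y ≡ suc (rank x) → z ≺ y → T z ≤ T x
  before-≤ e z≺y with before e z≺y
  ... | inj₁ refl = ≤-refl
  ... | inj₂ z≺x  = ≺⇒≤ z≺x

  Step : Fin n → Fin n → Set
  Step x y = T y ≡ T x × col′ x < col′ y ⊎ T y ≡ suc (T x) × col′ y ≤ col′ x

  -- When the entry increases, the support `d` of the value `T y` precedes `y`, which forces `T d`
  -- to equal `T x` and `d` to lie weakly left of `x`. An occurrence of `T y` left of `y` would
  -- precede `y` and so have an entry at most `T x`. Hence `col′ y ≤ col′ l ≤ col′ d ≤ col′ x`.
  step : ∀ {x y} → rank y ≡ suc (rank x) → Step x y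
  step {x} {y} e with rank-reflects {x} {y} (≤-reflexive (sym e))
  ... | inj₂ (f , p)  = inj₁ (sym f , p)
  ... | inj₁ Tx<Ty with quasi y (≤-<-trans (entry>0 x) Tx<Ty)
  ...   | l , Tl≡Ty , _ , d , Td≡ , l≤d = inj₂ (trans (sym Td≡) (cong suc Td≡Tx) , ≤-trans y≤l (≤-trans l≤d d≤x))
    where
    d≺y : d ≺ y
    d≺y = inj₁ (≤-reflexive Td≡)

    Td≡Tx : T d ≡ T x
    Td≡Tx = ≤-antisym (before-≤ e d≺y) (s≤s⁻¹ (<-≤-trans Tx<Ty (≤-reflexive (sym Td≡))))

    d≤x : col′ d ≤ col′ x
    d≤x with before e d≺y
    ... | inj₁ refl           = ≤-refl
    ... | inj₂ (inj₁ p)       = contradiction p (<-irrefl Td≡Tx)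
    ... | inj₂ (inj₂ (_ , p)) = <⇒≤ p

    y≤l : col′ y ≤ col′ l
    y≤l = ≮⇒≥ λ l<y → <⇒≱ Tx<Ty (≤-trans (≤-reflexive (sym Tl≡Ty)) (before-≤ e (inj₂ (Tl≡Ty , l<y))))

  first-entry : ∀ {y} → rank y ≡ 0 → T y ≡ 1
  first-entry {y} e = ≤-antisym (≮⇒≥ λ 1<Ty → no-smaller (quasi y 1<Ty)) (entry>0 y)
    where
    no-smaller : ¬ Supported col′ T (T y)
    no-smaller (_ , _ , _ , d , Td≡ , _) = n≮0 (<-≤-trans (rank-strict {d} {y} (inj₁ (≤-reflexive Td≡))) (≤-reflexive e))

  -- Entries start at 1 and rise by at most one per step. Consequently the subtraction in `dual` is
  -- never truncated.
  T≤1+rank : ∀ x → T x ≤ suc (rank x)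
  T≤1+rank = rank-induction _ (λ e → ≤-trans (≤-reflexive (first-entry e)) z<s) next
    where
    next : ∀ {x y} → rank y ≡ suc (rank x) → T x ≤ suc (rank x) → T y ≤ suc (rank y)
    next {x} e ih = ≤-trans T≤1+T (s≤s (≤-trans ih (≤-reflexive (sym e))))
      where
      T≤1+T : T _ ≤ suc (T x)
      T≤1+T with step {x} e
      ... | inj₁ (f , _) = m≤n⇒m≤1+n (≤-reflexive f)
      ... | inj₂ (f , _) = ≤-reflexive f

  dual+T : ∀ x → dual x + T x ≡ 2 + rank x
  dual+T x = m∸n+n≡m (m≤n⇒m≤1+n (T≤1+rank x))

  dual-positive : ∀ x → 0 < dual x
  dual-positive x = m<n⇒0<n∸m (s≤s (T≤1+rank x))

  first-dual : ∀ {y} → rank y ≡ 0 → dual y ≡ 1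
  first-dual {y} e = cong₂ (λ r t → 2 + r ∸ t) e (first-entry e)

  DualStep : Fin n → Fin n → Set
  DualStep x y = dual y ≡ suc (dual x) × row′ y ≤ row′ x
               ⊎ dual y ≡ dual x × row′ x < row′ y × col′ y ≤ col′ x

  -- Where `T` is constant the column moves right, and a row moving up would contradict `strict`.
  -- Where `T` rises the column moves weakly left, and a row not moving up would contradict `weak`.
  dualStep : ∀ {x y} → rank y ≡ suc (rank x) → DualStep x y
  dualStep {x} {y} e with step {x} e
  ... | inj₁ (f , x<y) = inj₁
    ( trans (cong₂ (λ r t → 2 + r ∸ t) e f) (+-∸-assoc 1 (m≤n⇒m≤1+n (T≤1+rank x)))
    , ≮⇒≥ λ r → <-irrefl (sym f) (strict r (<⇒≤ x<y)) )
  ... | inj₂ (f , y≤x) = inj₂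
    ( cong₂ (λ r t → 2 + r ∸ t) e f
    , ≰⇒> (λ r → <⇒≱ (≤-reflexive (sym f)) (weak r y≤x))
    , y≤x )

  -- A transitive relation containing `DualStep`. It is the reading order of `dual` on the flipped
  -- shape, with an extra column clause on ties that rules them out in `dual-strict`.
  Later : Fin n → Fin n → Set
  Later x y = dual x < dual y ⊎ dual x ≡ dual y × row′ x < row′ y × col′ y ≤ col′ x

  later-trans : ∀ {x y z} → Later x y → Later y z → Later x z
  later-trans (inj₁ p)           (inj₁ q)           = inj₁ (<-trans p q)
  later-trans (inj₁ p)           (inj₂ (e , _))     = inj₁ (<-≤-trans p (≤-reflexive e))
  later-trans (inj₂ (e , _))     (inj₁ q)           = inj₁ (≤-<-trans (≤-reflexive e) q)
  later-trans (inj₂ (e , p , u)) (inj₂ (f , q , v)) = inj₂ (trans e f , <-trans p q , ≤-trans v u)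

  dualStep⇒later : ∀ {x y} → DualStep x y → Later x y
  dualStep⇒later (inj₁ (e , _))     = inj₁ (≤-reflexive (sym e))
  dualStep⇒later (inj₂ (e , p , q)) = inj₂ (sym e , p , q)

  ≺⇒later : ∀ {x y} → x ≺ y → Later x y
  ≺⇒later {y = y} = rank-induction (λ y → ∀ {x} → x ≺ y → Later x y) base next y
    where
    base : ∀ {y} → rank y ≡ 0 → ∀ {x} → x ≺ y → Later x y
    base e x≺y = contradiction (<-≤-trans (rank-strict x≺y) (≤-reflexive e)) n≮0

    next : ∀ {p y} → rank y ≡ suc (rank p) → (∀ {x} → x ≺ p → Later x p) → ∀ {x} → x ≺ y → Later x y
    next e ih x≺y with before e x≺y
    ... | inj₁ refl = dualStep⇒later (dualStep e)
    ... | inj₂ x≺p  = later-trans (ih x≺p) (dualStep⇒later (dualStep e))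

  later⇒≤ : ∀ {x y} → Later x y → dual x ≤ dual y
  later⇒≤ (inj₁ p)       = <⇒≤ p
  later⇒≤ (inj₂ (e , _)) = ≤-reflexive e

  -- The box `y` cannot come first: that would need a smaller entry, against `weak`, or a smaller
  -- column, against `c`.
  dual-weak : ∀ {x y} → col′ x ≤ col′ y → row′ x ≤ row′ y → dual x ≤ dual y
  dual-weak {x} {y} c r with ≺-cmp x y
  ... | inj₁ x≺y                     = later⇒≤ (≺⇒later x≺y)
  ... | inj₂ (inj₁ refl)             = ≤-refl
  ... | inj₂ (inj₂ (inj₁ p))         = contradiction p (≤⇒≯ (weak r c))
  ... | inj₂ (inj₂ (inj₂ (_ , p)))   = contradiction p (≤⇒≯ c)

  -- Here `x` precedes `y`, and a tie of dual values would put `y` weakly left of `x`.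
  dual-strict : ∀ {x y} → col′ x < col′ y → row′ x ≤ row′ y → dual x < dual y
  dual-strict {x} {y} c r with ≺⇒later x≺y
    where
    x≺y : x ≺ y
    x≺y with m≤n⇒m<n∨m≡n (weak {x} {y} r (<⇒≤ c))
    ... | inj₁ p = inj₁ p
    ... | inj₂ e = inj₂ (e , c)
  ... | inj₁ p           = p
  ... | inj₂ (_ , _ , q) = contradiction q (<⇒≱ c)

  -- Along the reading order, a step with constant dual value passes on the support already found.
  -- At a rising step `y` is the first box with its value, later boxes with that value lie in higher
  -- rows, and the predecessor `x` is the support.
  dual-quasi : ∀ x → 1 < dual x → Supported row′ dual (dual x)
  dual-quasi = rank-induction _ (λ e 1<y → contradiction 1<y (<-irrefl (sym (first-dual e)))) next
    where
    next : ∀ {x y} → rank y ≡ suc (rank x) → (1 < dual x → Supported row′ dual (dual x)) →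
           1 < dual y → Supported row′ dual (dual y)
    next {x} {y} e ih 1<y with dualStep {x} e
    ... | inj₂ (f , _)   = subst (Supported row′ dual) (sym f) (ih (subst (1 <_) f 1<y))
    ... | inj₁ (f , y≤x) = y , refl , leftmost , x , sym f , y≤x
      where
      x<y : dual x < dual y
      x<y = ≤-reflexive (sym f)

      leftmost : ∀ z → dual z ≡ dual y → row′ y ≤ row′ z
      leftmost z g with ≺-cmp z y
      leftmost z g | inj₁ z≺y with before {x} e z≺y
      ... | inj₁ refl = contradiction x<y (<-irrefl g)
      ... | inj₂ z≺x  = contradiction (≤-<-trans (later⇒≤ (≺⇒later z≺x)) x<y) (<-irrefl g)
      leftmost z g | inj₂ (inj₁ refl) = ≤-refl
      leftmost z g | inj₂ (inj₂ y≺z) with ≺⇒later y≺z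
      ... | inj₁ p           = contradiction p (<-irrefl (sym g))
      ... | inj₂ (_ , p , _) = <⇒≤ p

  dual-isQYT : IsQYT (flip S) dual
  dual-isQYT = record
    { entry>0 = dual-positive ; weak = dual-weak ; strict = dual-strict ; quasi = dual-quasi }

  private module Dual = ReadingOrder (flip S) dual

  ≺⇒dual≺ : ∀ {x y} → x ≺ y → x Dual.≺ y
  ≺⇒dual≺ x≺y with ≺⇒later x≺y
  ... | inj₁ p           = inj₁ p
  ... | inj₂ (e , p , _) = inj₂ (e , p)

  dual≺⇒≺ : ∀ {x y} → x Dual.≺ y → x ≺ y
  dual≺⇒≺ {x} {y} p with ≺-cmp x y
  ... | inj₁ x≺y         = x≺y
  ... | inj₂ (inj₁ refl) = contradiction p Dual.≺-irrefl
  ... | inj₂ (inj₂ y≺x)  = contradiction (Dual.≺-trans p (≺⇒dual≺ y≺x)) Dual.≺-irrefl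

  -- Both fillings induce the same order, hence the same ranks, and subtracting `dual x` from
  -- `dual x + T x` leaves `T x`.
  dual-involutive : ∀ x → Dual.dual x ≡ T x
  dual-involutive x = begin
    2 + Dual.rank x ∸ dual x ≡⟨ cong (λ r → 2 + r ∸ dual x) (sym (rank-cong S {flip S} ≺⇒dual≺ dual≺⇒≺ x)) ⟩
    2 + rank x ∸ dual x      ≡⟨ cong (_∸ dual x) (dual+T x) ⟨
    dual x + T x ∸ dual x    ≡⟨ m+n∸m≡n (dual x) (T x) ⟩
    T x                      ∎
    where open ≡-Reasoning

  -- The given box shows that `n` is a successor, so that the rank `n - 1` exists.
  lastBox : Fin n → ∃ λ z → suc (rank z) ≡ n
  lastBox x with pred[n] x
    where
    pred[n] : ∀ {k} → Fin k → ∃ λ j → suc j ≡ k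
    pred[n] {suc k} _ = k , refl
  ... | j , e with atRank (≤-reflexive e)
  ...   | z , f = z , trans (cong suc f) e

  -- Both `T` and `dual` are weakly increasing along the reading order, so both attain their maximum
  -- at the last box `z`, where they add up to `2 + rank z`, that is `n + 1`.
  dual-largest : ∀ {m} → Largest T m → Largest dual (+ suc n - m)
  dual-largest {m} ((x₀ , Tx₀≡m) , T≤m) = at-last (lastBox x₀)
    where
    module _ (z : Fin n) (rank-z : suc (rank z) ≡ n) where

      z-last : ∀ x → x ≡ z ⊎ x ≺ z
      z-last x with ≺-cmp x z
      ... | inj₁ x≺z        = inj₂ x≺z
      ... | inj₂ (inj₁ x≡z) = inj₁ x≡z
      ... | inj₂ (inj₂ z≺x) = contradiction (rank<n x) (≤⇒≯ (≤-trans (≤-reflexive (sym rank-z)) (rank-strict z≺x)))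

      z-max : ∀ x → dual x ≤ dual z
      z-max x with z-last x
      ... | inj₁ x≡z  = ≤-reflexive (cong dual x≡z)
      ... | inj₂ x≺z  = later⇒≤ (≺⇒later x≺z)

      Tz≡m : + T z ≡ m
      Tz≡m with z-last x₀
      ... | inj₁ e    = trans (cong (+_ ∘ T) (sym e)) Tx₀≡m
      ... | inj₂ x≺z  = ℤ.≤-antisym (T≤m z) (ℤ.≤-trans (ℤ.≤-reflexive (sym Tx₀≡m)) (ℤ.+≤+ (≺⇒≤ x≺z)))

      z-dual : + dual z ≡ + suc n - m
      z-dual = begin
        + dual z                        ≡⟨ ℤ.+-identityʳ _ ⟨
        + dual z ℤ.+ + 0                ≡⟨ cong (ℤ._+_ (+ dual z)) (ℤ.+-inverseʳ (+ T z)) ⟨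
        + dual z ℤ.+ (+ T z - + T z)    ≡⟨ ℤ.+-assoc (+ dual z) (+ T z) (ℤ.- + T z) ⟨
        + (dual z + T z) - + T z        ≡⟨ cong₂ (λ a b → + a - b) (trans (dual+T z) (cong suc rank-z)) Tz≡m ⟩
        + suc n - m                     ∎
        where open ≡-Reasoning

    at-last : (∃ λ z → suc (rank z) ≡ n) → Largest dual (+ suc n - m)
    at-last (z , e) =
      (z , z-dual z e) , λ x → ℤ.≤-trans (ℤ.+≤+ (z-max z e x)) (ℤ.≤-reflexive (z-dual z e))

-- Young diagrams

-- Row lengths extended by 0 above the diagram, so that membership of a cell reads `c < part ps r`
-- with plain natural numbers.
part : List ℕ → ℕ → ℕ
part []       _       = 0
part (p ∷ ps) zero    = p
part (p ∷ ps) (suc r) = part ps r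

part-lookup : ∀ ps (i : Fin (length ps)) → part ps (toℕ i) ≡ lookup ps i
part-lookup (p ∷ ps) zero    = refl
part-lookup (p ∷ ps) (suc i) = part-lookup ps i

part⇒<length : ∀ ps r {c} → c < part ps r → r < length ps
part⇒<length (p ∷ ps) zero    _ = z<s
part⇒<length (p ∷ ps) (suc r) h = s≤s (part⇒<length ps r h)

part-≤ : ∀ {w ps} → All (_≤ w) ps → ∀ r → part ps r ≤ w
part-≤ []         r       = z≤n
part-≤ (p≤w ∷ _)  zero    = p≤w
part-≤ (_ ∷ ps≤w) (suc r) = part-≤ ps≤w r

part-antitone : ∀ {ps} → Linked _≥_ ps → ∀ {r s} → r ≤ s → part ps s ≤ part ps r
part-antitone {[]}     _   _         = z≤n
part-antitone {p ∷ ps} ps↓ {s = s} z≤n = part-≤ (parts≤width ps↓) s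
part-antitone {p ∷ ps} ps↓ (s≤s r≤s) = part-antitone (Linked.tail ps↓) r≤s

columnHeight-accept : ∀ {p c} ps → c < p → columnHeight (p ∷ ps) c ≡ suc (columnHeight ps c)
columnHeight-accept {c = c} ps c<p = cong length (filter-accept (c <?_) {xs = ps} c<p)

columnHeight-none : ∀ {c ps} → All (_≤ c) ps → columnHeight ps c ≡ 0
columnHeight-none {c} ps≤c = cong length (filter-none (c <?_) (All.map ≤⇒≯ ps≤c))

columnHeight-≥width : ∀ {ps c} → Linked _≥_ ps → width ps ≤ c → columnHeight ps c ≡ 0
columnHeight-≥width ps↓ w≤c = columnHeight-none (All.map (λ q≤w → ≤-trans q≤w w≤c) (parts≤width ps↓))

-- As the parts decrease, the rows longer than `c` are exactly the lowest `columnHeight ps c` rows.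
-- With the converse below, this says that conjugation transposes cells.
part⇒columnHeight : ∀ {ps} → Linked _≥_ ps → ∀ r {c} → c < part ps r → r < columnHeight ps c
part⇒columnHeight {p ∷ ps} ps↓ zero h =
  subst (0 <_) (sym (columnHeight-accept ps h)) z<s
part⇒columnHeight {p ∷ ps} ps↓ (suc r) h =
  subst (suc r <_) (sym (columnHeight-accept ps (<-≤-trans h (part-antitone ps↓ (z≤n {suc r})))))
    (s≤s (part⇒columnHeight (Linked.tail ps↓) r h))

columnHeight⇒part : ∀ {ps} → Linked _≥_ ps → ∀ r {c} → r < columnHeight ps c → c < part ps r
columnHeight⇒part {p ∷ ps} ps↓ r {c} h with c <? p
columnHeight⇒part {p ∷ ps} ps↓ zero    h | yes c<p = c<p
columnHeight⇒part {p ∷ ps} ps↓ (suc r) h | yes c<p =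
  columnHeight⇒part (Linked.tail ps↓) r (s≤s⁻¹ (subst (suc r <_) (columnHeight-accept ps c<p) h))
columnHeight⇒part {p ∷ ps} ps↓ r       h | no  c≮p =
  contradiction (subst (r <_) (columnHeight-≥width ps↓ (≮⇒≥ c≮p)) h) n≮0

part-applyUpTo : ∀ f {w i} → i < w → part (applyUpTo f w) i ≡ f i
part-applyUpTo f {suc w} {zero}  _         = refl
part-applyUpTo f {suc w} {suc i} (s≤s i<w) = part-applyUpTo (f ∘ suc) i<w

part-conjugateParts : ∀ {ps} → Linked _≥_ ps → ∀ c → part (conjugateParts ps) c ≡ columnHeight ps c
part-conjugateParts {ps} ps↓ c with c <? width ps
... | yes c<w = part-applyUpTo (columnHeight ps) c<w
... | no  c≮w = trans (n≤0⇒n≡0 (≮⇒≥ beyond)) (sym (columnHeight-≥width ps↓ (≮⇒≥ c≮w)))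
  where
  beyond : ¬ 0 < part (conjugateParts ps) c
  beyond h = c≮w (subst (c <_) (length-applyUpTo (columnHeight ps) (width ps)) (part⇒<length (conjugateParts ps) c h))

box-injective : ∀ {n} {μ : Partition n} {b c : Box μ} → row b ≡ row c → col b ≡ col c → b ≡ c
box-injective {b = box i j} {box k l} p q with toℕ-injective p
... | refl = cong (box i) (toℕ-injective q)

module _ {n} (μ : Partition n) where

  inDiagram : (b : Box μ) → col b < part (parts μ) (row b)
  inDiagram b = subst (col b <_) (sym (part-lookup (parts μ) (rowIndex b))) (toℕ<n (colIndex b))

  boxAt : ∀ r c → c < part (parts μ) r → ∃ λ (b : Box μ) → row b ≡ r × col b ≡ c
  boxAt r c h = box i (fromℕ< c<) , toℕ-fromℕ< r< , toℕ-fromℕ< c<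
    where
    r< = part⇒<length (parts μ) r h
    i  = fromℕ< r<
    c< : c < lookup (parts μ) i
    c< = subst (c <_) (trans (cong (part (parts μ)) (sym (toℕ-fromℕ< r<))) (part-lookup (parts μ) i)) h

  -- A Young diagram is closed under moving down and left because its parts decrease.
  boxBelow : (b : Box μ) → ∀ {r c} → r ≤ row b → c ≤ col b → ∃ λ (d : Box μ) → row d ≡ r × col d ≡ c
  boxBelow b {r} {c} r≤ c≤ =
    boxAt r c (≤-<-trans c≤ (<-≤-trans (inDiagram b) (part-antitone (decreasing μ) r≤)))

-- Numbering the boxes of a diagram

decode : ∀ ps → Fin (sum ps) → Σ (Fin (length ps)) (Fin ∘ lookup ps)
decode (p ∷ ps) x with splitAt p x
... | inj₁ j = zero , j
... | inj₂ y = let i , j = decode ps y in suc i , j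

encode : ∀ ps (i : Fin (length ps)) → Fin (lookup ps i) → Fin (sum ps)
encode (p ∷ ps) zero    j = j ↑ˡ sum ps
encode (p ∷ ps) (suc i) j = p ↑ʳ encode ps i j

decode-encode : ∀ ps i j → decode ps (encode ps i j) ≡ (i , j)
decode-encode (p ∷ ps) zero    j rewrite splitAt-↑ˡ p j (sum ps) = refl
decode-encode (p ∷ ps) (suc i) j rewrite splitAt-↑ʳ p (sum ps) (encode ps i j) | decode-encode ps i j = refl

encode-decode : ∀ ps x → encode ps (proj₁ (decode ps x)) (proj₂ (decode ps x)) ≡ x
encode-decode (p ∷ ps) x with splitAt p x in eq
... | inj₁ j = splitAt⁻¹-↑ˡ eq
... | inj₂ y = trans (cong (p ↑ʳ_) (encode-decode ps y)) (splitAt⁻¹-↑ʳ eq)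

-- Identifies the boxes of `ν` with numbers below `n`. A partition and its conjugate share one
-- numbering, with shapes `S` and `flip S`, so a filling and its dual are functions on the same set.
record Coordinates {n} (ν : Partition n) (S : Shape n) : Set where
  field
    boxOf   : Fin n → Box ν
    index   : Box ν → Fin n
    boxRow  : ∀ x → row (boxOf x) ≡ rowOf S x
    boxCol  : ∀ x → col (boxOf x) ≡ colOf S x
    boxOf-index : ∀ b → boxOf (index b) ≡ b

  indexRow : ∀ b → rowOf S (index b) ≡ row b
  indexRow b = trans (sym (boxRow (index b))) (cong row (boxOf-index b))

  indexCol : ∀ b → colOf S (index b) ≡ col b
  indexCol b = trans (sym (boxCol (index b))) (cong col (boxOf-index b))

  index-boxOf : ∀ x → index (boxOf x) ≡ x
  index-boxOf x = injective S (trans (indexRow (boxOf x)) (boxRow x)) (trans (indexCol (boxOf x)) (boxCol x))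

module _ {n} (μ : Partition n) where

  private
    unrank : Fin n → Box μ
    unrank x = let i , j = decode (parts μ) (Fin.cast (sym (sum-parts μ)) x) in box i j

    number : Box μ → Fin n
    number (box i j) = Fin.cast (sum-parts μ) (encode (parts μ) i j)

    unrank-number : ∀ b → unrank (number b) ≡ b
    unrank-number (box i j) = cong (λ (k , l) → box k l) (trans
      (cong (decode (parts μ)) (Fin.cast-involutive (sym (sum-parts μ)) (sum-parts μ) (encode (parts μ) i j)))
      (decode-encode (parts μ) i j))

    number-unrank : ∀ x → number (unrank x) ≡ x
    number-unrank x = trans
      (cong (Fin.cast (sum-parts μ)) (encode-decode (parts μ) (Fin.cast (sym (sum-parts μ)) x)))
      (Fin.cast-involutive (sum-parts μ) (sym (sum-parts μ)) x)

  shape : Shape n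
  shape = record
    { rowOf     = row ∘ unrank
    ; colOf     = col ∘ unrank
    ; injective = λ {x} {y} p q →
        trans (sym (number-unrank x)) (trans (cong number (box-injective p q)) (number-unrank y))
    }

  coordinates : Coordinates μ shape
  coordinates = record
    { boxOf = unrank ; index = number ; boxRow = λ _ → refl ; boxCol = λ _ → refl
    ; boxOf-index = unrank-number }

  transposeFrom : (d : Box (conjugate μ)) → ∃ λ (b : Box μ) → row b ≡ col d × col b ≡ row d
  transposeFrom d = boxAt μ (col d) (row d) (columnHeight⇒part (decreasing μ) (col d)
    (subst (col d <_) (part-conjugateParts (decreasing μ) (row d)) (inDiagram (conjugate μ) d)))

  transposeTo : (b : Box μ) → ∃ λ (d : Box (conjugate μ)) → row d ≡ col b × col d ≡ row b
  transposeTo b = boxAt (conjugate μ) (col b) (row b) (subst (row b <_)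
    (sym (part-conjugateParts (decreasing μ) (col b))) (part⇒columnHeight (decreasing μ) (row b) (inDiagram μ b)))

  -- Each box of the conjugate takes the number of its transpose in `μ`.
  conjugateCoordinates : Coordinates (conjugate μ) (flip shape)
  conjugateCoordinates = record
    { boxOf  = λ x → proj₁ (transposeTo (unrank x))
    ; index  = λ d → number (proj₁ (transposeFrom d))
    ; boxRow = λ x → proj₁ (proj₂ (transposeTo (unrank x)))
    ; boxCol = λ x → proj₂ (proj₂ (transposeTo (unrank x)))
    ; boxOf-index = λ d → let b , b-row , b-col = transposeFrom d in
        trans (cong (proj₁ ∘ transposeTo) (unrank-number b))
          (box-injective (trans (proj₁ (proj₂ (transposeTo b))) b-col)
                         (trans (proj₂ (proj₂ (transposeTo b))) b-row))
    }

-- Tableaux as fillings of numbered boxes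

module _ {n} {ν : Partition n} {S : Shape n} (C : Coordinates ν S) where
  open Coordinates C

  entries : ∀ {m} → QYT m ν → Fin n → ℕ
  entries T x = filling T (boxOf x)

  entries-largest : ∀ {m} (T : QYT m ν) → Largest (entries T) m
  entries-largest T with largestEntry T
  ... | (b , e) , le = (index b , trans (cong (+_ ∘ filling T) (boxOf-index b)) e) , λ x → le (boxOf x)

  entries-isQYT : ∀ {m} (T : QYT m ν) → IsQYT S (entries T)
  entries-isQYT T = record
    { entry>0 = λ x → entries-positive (boxOf x)
    ; weak     = λ {x} {y} r c → weak
        (subst₂ _≤_ (sym (boxRow x)) (sym (boxRow y)) r) (subst₂ _≤_ (sym (boxCol x)) (sym (boxCol y)) c)
    ; strict   = λ {x} {y} r c → strict
        (subst₂ _<_ (sym (boxRow x)) (sym (boxRow y)) r) (subst₂ _≤_ (sym (boxCol x)) (sym (boxCol y)) c)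
    ; quasi    = quasi
    }
    where
    open IsSSYT (isSSYT T)
    F = filling T

    along-row : ∀ {b c} → row b ≡ row c → col b ≤ col c → F b ≤ F c
    along-row {b} {c} r p with m≤n⇒m<n∨m≡n p
    ... | inj₁ q = rows-weakly-incr b c r q
    ... | inj₂ q = ≤-reflexive (cong F (box-injective r q))

    -- Pass through the corner box `d` in the row of `b` and the column of `c`: weakly along the
    -- row, then strictly up the column.
    strict : ∀ {b c} → row b < row c → col b ≤ col c → F b < F c
    strict {b} {c} r p with boxBelow ν c (<⇒≤ r) ≤-refl
    ... | d , d-row , d-col = ≤-<-trans
      (along-row (sym d-row) (≤-trans p (≤-reflexive (sym d-col))))
      (cols-strictly-incr d c d-col (≤-<-trans (≤-reflexive d-row) r))

    weak : ∀ {b c} → row b ≤ row c → col b ≤ col c → F b ≤ F c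
    weak r p with m≤n⇒m<n∨m≡n r
    ... | inj₁ q = <⇒≤ (strict q p)
    ... | inj₂ q = along-row q p

    quasi : ∀ x → 1 < F (boxOf x) → Supported (colOf S) (F ∘ boxOf) (F (boxOf x))
    quasi x 1<x with quasiYamanouchi T _ 1<x (boxOf x , refl)
    ... | b , (b≡ , leftmost) , c , c≡ , b≤c =
      index b
      , trans (cong F (boxOf-index b)) b≡
      , (λ y e → subst₂ _≤_ (sym (indexCol b)) (boxCol y) (leftmost (boxOf y) e))
      , index c
      , trans (cong suc (trans (cong F (boxOf-index c)) c≡)) (m+[n∸m]≡n (<⇒≤ 1<x))
      , subst₂ _≤_ (sym (indexCol b)) (sym (indexCol c)) b≤c

  fromEntries : ∀ {m} (U : Fin n → ℕ) → IsQYT S U → Largest U m → QYT m ν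
  fromEntries {m} U isQYT ((x , x≡m) , ≤m) = record
    { filling = U ∘ index
    ; isSSYT  = record
      { entries-positive   = λ b → entry>0 (index b)
      ; rows-weakly-incr   = λ b c r p → weak
          (≤-reflexive (indexRow-≡ r)) (subst₂ _≤_ (sym (indexCol b)) (sym (indexCol c)) (<⇒≤ p))
      ; cols-strictly-incr = λ b c p r → strict
          (subst₂ _<_ (sym (indexRow b)) (sym (indexRow c)) r) (≤-reflexive (indexCol-≡ p))
      }
    ; quasiYamanouchi = λ { _ 1<i (b , refl) → quasiYam b 1<i }
    ; largestEntry    = (boxOf x , trans (cong (+_ ∘ U) (index-boxOf x)) x≡m) , λ b → ≤m (index b)
    }
    where
    open IsQYT isQYT

    indexRow-≡ : ∀ {b c} → row b ≡ row c → rowOf S (index b) ≡ rowOf S (index c)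
    indexRow-≡ {b} {c} r = trans (indexRow b) (trans r (sym (indexRow c)))

    indexCol-≡ : ∀ {b c} → col b ≡ col c → colOf S (index b) ≡ colOf S (index c)
    indexCol-≡ {b} {c} r = trans (indexCol b) (trans r (sym (indexCol c)))

    quasiYam : ∀ b → 1 < U (index b) →
               ∃ λ l → IsLeftmostOccurrence {μ = ν} (U ∘ index) (U (index b)) l ×
               ∃ λ d → U (index d) ≡ U (index b) ∸ 1 × col l ≤ col d
    quasiYam b 1<b with quasi (index b) 1<b
    ... | l , l≡ , leftmost , d , d≡ , l≤d =
      boxOf l
      , ( trans (cong U (index-boxOf l)) l≡
        , λ c e → subst₂ _≤_ (sym (boxCol l)) (indexCol c) (leftmost (index c) e) )
      , boxOf d
      , trans (cong U (index-boxOf d)) (cong (_∸ 1) d≡)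
      , subst₂ _≤_ (sym (boxCol l)) (sym (boxCol d)) l≤d

-- The bijection between tableaux of conjugate shapes

module _ {n} {ν ν′ : Partition n} {S : Shape n} (C : Coordinates ν S) (C′ : Coordinates ν′ (flip S)) where
  private
    module C  = Coordinates C
    module C′ = Coordinates C′

  dualTableau : ∀ {m} → QYT m ν → QYT (+ suc n - m) ν′
  dualTableau T = fromEntries C′ (ReadingOrder.dual S (entries C T))
    (Duality.dual-isQYT (entries-isQYT C T)) (Duality.dual-largest (entries-isQYT C T) (entries-largest C T))

  dualTableau-cong : ∀ {m} {T U : QYT m ν} → (∀ b → filling T b ≡ filling U b) →
                     ∀ b → filling (dualTableau T) b ≡ filling (dualTableau U) b
  dualTableau-cong {T = T} {U} eq b = dual-cong S {entries C T} {entries C U} (eq ∘ C.boxOf) (C′.index b)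

-- U stands for dualTableau C C′ T up to a change of the index m, because two
-- applications of dualTableau end in QYT (n + 1 − (n + 1 − m)), not in QYT m.
dualTableau-inverse :
  ∀ {n m m′} {ν ν′ : Partition n} {S : Shape n} (C : Coordinates ν S) (C′ : Coordinates ν′ (flip S)) →
  (T : QYT m ν) (U : QYT m′ ν′) → (∀ b → filling U b ≡ filling (dualTableau C C′ T) b) →
  ∀ b → filling (dualTableau C′ C U) b ≡ filling T b
dualTableau-inverse {S = S} C C′ T U eq b = begin
  ReadingOrder.dual (flip S) (entries C′ U) (C.index b)
    ≡⟨ dual-cong (flip S) (λ x → trans (eq (C′.boxOf x)) (cong (ReadingOrder.dual S (entries C T)) (C′.index-boxOf x))) (C.index b) ⟩
  ReadingOrder.dual (flip S) (ReadingOrder.dual S (entries C T)) (C.index b)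
    ≡⟨ Duality.dual-involutive (entries-isQYT C T) (C.index b) ⟩
  filling T (C.boxOf (C.index b))
    ≡⟨ cong (filling T) (C.boxOf-index b) ⟩
  filling T b ∎
  where
  open ≡-Reasoning
  module C  = Coordinates C
  module C′ = Coordinates C′

relabel : ∀ {n m m′} {ν : Partition n} → m ≡ m′ → QYT m ν → QYT m′ ν
relabel {ν = ν} eq = subst (λ k → QYT k ν) eq

filling-relabel : ∀ {n m m′} {ν : Partition n} (eq : m ≡ m′) (T : QYT m ν) → ∀ b → filling (relabel eq T) b ≡ filling T b
filling-relabel refl T b = refl

n-[n-m]≡m : ∀ n m → n - (n - m) ≡ m
n-[n-m]≡m n m = begin
  n - (n - m)               ≡⟨ cong (ℤ._+_ n) (ℤ.neg-distrib-+ n (ℤ.- m)) ⟩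
  n ℤ.+ (ℤ.- n - ℤ.- m)     ≡⟨ ℤ.+-assoc n (ℤ.- n) (ℤ.- (ℤ.- m)) ⟨
  (n - n) - ℤ.- m           ≡⟨ cong₂ ℤ._+_ (ℤ.+-inverseʳ n) (ℤ.neg-involutive m) ⟩
  + 0 ℤ.+ m                 ≡⟨ ℤ.+-identityˡ m ⟩
  m                         ∎
  where open ≡-Reasoning

theorem3p3 : (n : ℕ) (μ : Partition n) (m : ℤ) →
    Inverse (QYT₌ m μ) (QYT₌ (+ (suc n) - m) (conjugate μ))
theorem3p3 n μ m = record
  { to        = to
  ; from      = from
  ; to-cong   = λ {T} {U} → to-cong {T} {U}
  ; from-cong = λ {T} {U} → from-cong {T} {U}
  -- Each inverse law concerns any `U` equivalent to the image of `T`, so congruence first replaces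
  -- `U` by that image.
  ; inverse   =
      (λ {T} {U} U≈ b → trans (to-cong {U} {from T} U≈ b)
        (dualTableau-inverse C′ C T (from T) (filling-relabel eq (dualTableau C′ C T)) b))
    , (λ {T} {U} U≈ b → trans (from-cong {U} {to T} U≈ b)
        (trans (filling-relabel eq (dualTableau C′ C (to T)) b)
               (dualTableau-inverse C C′ T (to T) (λ _ → refl) b)))
  }
  where
  C  = coordinates μ
  C′ = conjugateCoordinates μ
  eq = n-[n-m]≡m (+ suc n) m

  to : QYT m μ → QYT (+ suc n - m) (conjugate μ)
  to = dualTableau C C′

  from : QYT (+ suc n - m) (conjugate μ) → QYT m μ
  from T = relabel eq (dualTableau C′ C T)

  to-cong : ∀ {T U} → (∀ b → filling T b ≡ filling U b) → ∀ b → filling (to T) b ≡ filling (to U) b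
  to-cong {T} {U} = dualTableau-cong C C′ {T = T} {U}

  from-cong : ∀ {T U} → (∀ b → filling T b ≡ filling U b) → ∀ b → filling (from T) b ≡ filling (from U) b
  from-cong {T} {U} T≈U b = trans (filling-relabel eq (dualTableau C′ C T) b)
    (trans (dualTableau-cong C′ C {T = T} {U} T≈U b) (sym (filling-relabel eq (dualTableau C′ C U) b)))
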